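{- There exists a $(9,108)$-strategy for the GKS game; that is, in the GKS game with parameters $n=108$ and $k=9$, Alice and Bob have a winning strategy.
   Context: The GKS game with parameters $n,k$ (positive integers) is played by Alice and Bob as a team against Merlin. Alice and Bob may agree on a deterministic strategy beforehand but cannot communicate during play; Merlin may choose his moves knowing their strategy. A string $x=x_1\dots x_n$ of length $n$, initially empty, is filled as follows: Merlin picks an arbitrary permutation of $\{1,\dots,n\}$ and sends the indices one by one in this order to Alice. Upon receiving an index $i$ (other than the last index in the order), Alice must immediately choose the bit $x_i\in\{0,1\}$, knowing only the indices received so far (and the bits she chose). The last index of the permutation is not given to Alice; instead Merlin fills that position with a bit of his choice. The completed string $x\in\{0,1\}^n$ is then given to Bob, who must output a set $S$ of $k$ positions. Alice and Bob win if $S$ contains the position filled by Merlin. A $(k,n)$-strategy is a strategy for Alice and Bob that wins against every choice of Merlin (every permutation and every last bit). -}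

module Defs where

open import Data.Nat using (ℕ; suc)
open import Data.Bool using (Bool)
open import Data.Fin using (Fin; fromℕ)
open import Data.Fin.Properties using (_<?_)
open import Data.Fin.Subset using (Subset; ∣_∣; _∈_)
open import Data.Fin.Permutation using (Permutation′; _⟨$⟩ʳ_; _⟨$⟩ˡ_)
open import Data.List using (List; map; filter; allFin)
open import Relation.Binary.PropositionalEquality using (_≡_)
open import Relation.Nullary.Decidable using (does)
open import Data.Bool using (if_then_else_)
open import Data.Fin.Properties using (_≟_)

-- A deterministic strategy for Alice and Bob in the GKS game with
-- parameters k, n.
-- * Alice: given the list of indices received so far (in the order
--   received, excluding the current one) and the current index, she
--   chooses the bit for the current index.  (The bits she chose earlier
--   are determined by these data, so this is her full knowledge.)
-- * Bob: given the completed string x ∈ {0,1}^n, outputs a set of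
--   exactly k positions.
record Strategy (k n : ℕ) : Set where
  field
    alice   : List (Fin n) → Fin n → Bool
    bob     : (Fin n → Bool) → Subset n
    bob-card : ∀ x → ∣ bob x ∣ ≡ k
open Strategy public

-- Indices sent before time step j under the order π (π ⟨$⟩ʳ t is the
-- index sent at time t), in the order they were sent.
received-before : ∀ {n} → Permutation′ n → Fin n → List (Fin n)
received-before π j = map (π ⟨$⟩ʳ_) (filter (_<? j) (allFin _))

-- The string produced when Merlin sends the indices of Fin (suc m) in
-- the order π (the last one, π ⟨$⟩ʳ fromℕ m, is withheld from Alice)
-- and writes the bit b at that last position.
play : ∀ {k m} → Strategy k (suc m) → Permutation′ (suc m) → Bool
     → Fin (suc m) → Bool
play {m = m} s π b i =
  let j = π ⟨$⟩ˡ i in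
  if does (j ≟ fromℕ m) then b else alice s (received-before π j) i

Winning : ∀ {k m} → Strategy k (suc m) → Set
Winning {m = m} s =
  ∀ (π : Permutation′ (suc m)) (b : Bool) →
    (π ⟨$⟩ʳ fromℕ m) ∈ bob s (play s π b)

-- Split the 108 positions into 9 blocks of 12.  In each block Alice writes 0 at
-- the first three positions T she receives and then the bits of a codeword c_T
-- of a [12,8,3] code, except that she negates the bit of c_T at the last
-- position; c_T vanishes on T, so the word of a completed block is at distance
-- 1 from a codeword, and decoding reveals its last position.  Merlin's block is
-- either such a word, and then Bob decodes one position in every block, or it
-- is c_T itself, and then it is the only codeword among the blocks; as
-- T ↦ c_T is injective, Bob reads off T and answers with the 9 other positions
-- of that block.  There are 256 codewords for the 220 triples T, and enough of
-- them vanish on each triple for such a map to exist.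

module Submission where

open import Defs
open import Data.Bool using (Bool; true; false; not; _xor_; if_then_else_)
open import Data.Bool.Properties as Bool using (¬-not; xor-comm)
open import Data.Fin using (Fin; zero; suc; fromℕ)
open import Data.Fin.Permutation using (Permutation′; _⟨$⟩ʳ_; _⟨$⟩ˡ_; inverseˡ; inverseʳ)
open import Data.Fin.Properties using (_≟_; _<?_; any?; all?; *↔×; ≤fromℕ)
open import Data.Fin.Subset using (Subset; inside; outside; ⊥; ⊤; ∁; _∩_; ∣_∣; _⊆_) renaming (_∈_ to _∈ₛ_; _∉_ to _∉ₛ_)
open import Data.Fin.Subset.Properties using (_∈?_; ∣⊤∣≡n; ⊆⊤; ∉⊥; x∈p∩q⁺; x∉p⇒x∈∁p; ∣⊥∣≡0)
open import Data.List using (List; []; _∷_; [_]; _++_; _∷ʳ_; map; filter; find; foldr; take; length; tabulate; allFin; mapMaybe; initLast; _∷ʳ′_)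
open import Data.List.Membership.Propositional using (_∈_)
open import Data.List.Membership.Propositional.Properties using (∈-allFin; ∈-tabulate⁺; ∈-map⁺; ∈-++⁺ˡ; ∈-++⁺ʳ; ∈-filter⁺; ∈-insert)
open import Data.List.Membership.Propositional.Properties.WithK using (unique∧set⇒bag)
open import Data.List.Properties using (∷-injective; filter-none; filter-all; filter-≐; map-++; map-tabulate; mapMaybe-++; take-all; length-map; length-take; length-tabulate; length-++)
open import Data.List.Relation.Binary.BagAndSetEquality using (∼bag⇒↭)
open import Data.List.Relation.Binary.Permutation.Propositional.Properties using (↭-length)
open import Data.List.Relation.Unary.All as All using (All; []; _∷_)
open import Data.List.Relation.Unary.All.Properties as All using (mapMaybe⁺)
open import Data.List.Relation.Unary.Any using (here; there)
open import Data.List.Relation.Unary.Unique.Propositional using (Unique; []; _∷_)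
open import Data.List.Relation.Unary.Unique.Propositional.Properties as Unique using (allFin⁺)
open import Data.Maybe using (Maybe; just; nothing; maybe′)
open import Data.Maybe.Properties as Maybe using ()
open import Data.Maybe.Relation.Unary.All as MAll using (just; nothing)
open import Data.Nat using (ℕ; zero; suc; _≤_; z≤n; s≤s)
open import Data.Nat.Properties as ℕ using (_≤?_)
open import Data.Product using (Σ; ∃; ∃₂; _×_; _,_; proj₁; proj₂)
open import Data.Sum using (_⊎_; inj₁; inj₂; fromInj₁)
open import Data.Vec as Vec using (Vec; []; _∷_; lookup; zipWith; _[_]%=_; _[_]≔_)
open import Data.Vec.Properties as Vec using ([]≔-updates; []≔-minimal; lookup∘updateAt; lookup∘updateAt′; tabulate-cong; tabulate∘lookup; lookup⇒[]=; []=⇒lookup; lookup∘update′)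
open import Function using (_∘_; id; const; mk⇔; _↔_; Inverse)
open import Relation.Binary.PropositionalEquality using (_≡_; _≢_; refl; sym; trans; cong; cong₂; subst; module ≡-Reasoning)
open import Relation.Nullary using (Dec; does; yes; no; contradiction)
open import Relation.Nullary.Decidable using (¬?; _×-dec_; toWitness; map′; dec-true; dec-false)
open import Relation.Unary using (Decidable)

-- Finite sets and lists

∣insert∣≤ : ∀ {n} (S : Subset n) i → ∣ S [ i ]≔ inside ∣ ≤ suc ∣ S ∣
∣insert∣≤ (inside  ∷ S) zero    = ℕ.n≤1+n _
∣insert∣≤ (outside ∷ S) zero    = ℕ.≤-refl
∣insert∣≤ (inside  ∷ S) (suc i) = s≤s (∣insert∣≤ S i)
∣insert∣≤ (outside ∷ S) (suc i) = ∣insert∣≤ S i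

∣insert∣ : ∀ {n} (S : Subset n) i → lookup S i ≡ outside → ∣ S [ i ]≔ inside ∣ ≡ suc ∣ S ∣
∣insert∣ (outside ∷ S) zero    _   = refl
∣insert∣ (inside  ∷ S) (suc i) i∉S = cong suc (∣insert∣ S i i∉S)
∣insert∣ (outside ∷ S) (suc i) i∉S = ∣insert∣ S i i∉S

fromList : ∀ {n} → List (Fin n) → Subset n
fromList = foldr (λ i S → S [ i ]≔ inside) ⊥

∈-fromList⁺ : ∀ {n} {x : Fin n} {xs} → x ∈ xs → x ∈ₛ fromList xs
∈-fromList⁺ {xs = y ∷ xs} (here refl) = []≔-updates (fromList xs) y
∈-fromList⁺ {x = x} {xs = y ∷ xs} (there x∈xs) with x ≟ y
... | yes refl = []≔-updates (fromList xs) y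
... | no x≢y   = []≔-minimal (fromList xs) x y x≢y (∈-fromList⁺ x∈xs)

∉-fromList⁺ : ∀ {n} {x : Fin n} {xs} → All (x ≢_) xs → lookup (fromList xs) x ≡ outside
∉-fromList⁺ {x = x} [] = Vec.lookup-replicate x outside
∉-fromList⁺ {x = x} {xs = y ∷ xs} (x≢y ∷ x∉xs) =
  trans (lookup∘update′ x≢y (fromList xs) inside) (∉-fromList⁺ x∉xs)

∣fromList∣≤ : ∀ {n} (xs : List (Fin n)) → ∣ fromList xs ∣ ≤ length xs
∣fromList∣≤ {n} []   = ℕ.≤-reflexive (∣⊥∣≡0 n)
∣fromList∣≤ (x ∷ xs) = ℕ.≤-trans (∣insert∣≤ (fromList xs) x) (s≤s (∣fromList∣≤ xs))

∣fromList∣ : ∀ {n} {xs : List (Fin n)} → Unique xs → ∣ fromList xs ∣ ≡ length xs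
∣fromList∣ {n} []          = ∣⊥∣≡0 n
∣fromList∣ {xs = x ∷ xs} (x∉xs ∷ xs!) =
  trans (∣insert∣ (fromList xs) x (∉-fromList⁺ x∉xs)) (cong suc (∣fromList∣ xs!))

elements : ∀ {n} → Subset n → List (Fin n)
elements S = filter (_∈? S) (allFin _)

-- Bob must name exactly `k` positions, while his guesses may be fewer. Positions outside `S` are
-- left out while enough others remain; once they do not, `k` is the full size and `⊤` is taken.
enlarge : ∀ {n} k (S : Subset n) → ∣ S ∣ ≤ k → k ≤ n → ∃ λ S′ → S ⊆ S′ × ∣ S′ ∣ ≡ k
enlarge zero    []            _         _         = [] , id , refl
enlarge (suc k) (inside ∷ S)  (s≤s ∣S∣≤k) (s≤s k≤n) with enlarge k S ∣S∣≤k k≤n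
... | S′ , S⊆S′ , eq = inside ∷ S′ , (λ { Vec.here → Vec.here ; (Vec.there i∈S) → Vec.there (S⊆S′ i∈S) }) , cong suc eq
enlarge {suc n} k (outside ∷ S) ∣S∣≤k k≤1+n with k ≤? n
... | no k≰n  = ⊤ , ⊆⊤ , trans (∣⊤∣≡n (suc n)) (ℕ.≤-antisym (ℕ.≰⇒> k≰n) k≤1+n)
... | yes k≤n with enlarge k S ∣S∣≤k k≤n
...   | S′ , S⊆S′ , eq = outside ∷ S′ , (λ { (Vec.there i∈S) → Vec.there (S⊆S′ i∈S) }) , eq

filter-map : ∀ {A B : Set} {P : B → Set} (P? : Decidable P) (f : A → B) xs →
             filter P? (map f xs) ≡ map f (filter (P? ∘ f) xs)
filter-map P? f []       = refl
filter-map P? f (x ∷ xs) with does (P? (f x))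
... | false = filter-map P? f xs
... | true  = cong (f x ∷_) (filter-map P? f xs)

-- This cuts Merlin's order at time `j`, with the left part in the form that `received-before` uses.
allFin-split : ∀ {n} (j : Fin n) →
               allFin n ≡ filter (_<? j) (allFin n) ++ j ∷ filter (j <?_) (allFin n)
allFin-split {suc n} zero = sym (cong₂ (λ xs ys → xs ++ zero ∷ ys)
  (filter-none (_<? zero {n}) {tabulate suc} (All.tabulate⁺ λ _ ()))
  (filter-all (zero {n} <?_) {tabulate suc} (All.tabulate⁺ λ _ → s≤s z≤n)))
allFin-split {suc n} (suc j) = cong (zero ∷_) (begin
  tabulate suc                                     ≡⟨ map-tabulate id suc ⟨
  map suc (allFin n)                               ≡⟨ cong (map suc) (allFin-split j) ⟩
  map suc (filter (_<? j) (allFin n) ++ j ∷ filter (j <?_) (allFin n))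
    ≡⟨ map-++ suc (filter (_<? j) (allFin n)) _ ⟩
  map suc (filter (_<? j) (allFin n)) ++ suc j ∷ map suc (filter (j <?_) (allFin n))
    ≡⟨ cong₂ (λ xs ys → xs ++ suc j ∷ ys)
         (shift (_<? j) (_<? suc j) (s≤s , ℕ.≤-pred)) (shift (j <?_) (suc j <?_) (s≤s , ℕ.≤-pred)) ⟩
  filter (_<? suc j) (tabulate suc) ++ suc j ∷ filter (suc j <?_) (tabulate suc) ∎)
  where
  open ≡-Reasoning
  shift : ∀ {P : Fin n → Set} {Q : Fin (suc n) → Set} (P? : Decidable P) (Q? : Decidable Q) →
          (∀ {i} → P i → Q (suc i)) × (∀ {i} → Q (suc i) → P i) →
          map suc (filter P? (allFin n)) ≡ filter Q? (tabulate suc)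
  shift P? Q? P≐Q = begin
    map suc (filter P? (allFin n))         ≡⟨ cong (map suc) (filter-≐ P? (Q? ∘ suc) P≐Q (allFin n)) ⟩
    map suc (filter (Q? ∘ suc) (allFin n)) ≡⟨ filter-map Q? suc (allFin n) ⟨
    filter Q? (map suc (allFin n))         ≡⟨ cong (filter Q?) (map-tabulate id suc) ⟩
    filter Q? (tabulate suc)               ∎

mapMaybe-unique : ∀ {A B : Set} {f : A → Maybe B} →
                  (∀ {x y z} → f x ≡ just z → f y ≡ just z → x ≡ y) →
                  ∀ {xs} → Unique xs → Unique (mapMaybe f xs)
mapMaybe-unique inj [] = []
mapMaybe-unique {f = f} inj {x ∷ xs} (x∉xs ∷ xs!) with f x in fx
... | nothing = mapMaybe-unique inj xs!
... | just z  = mapMaybe⁺ (All.map⁺ (All.map avoids x∉xs)) ∷ mapMaybe-unique inj xs!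
  where
  avoids : ∀ {y} → x ≢ y → MAll.All (z ≢_) (f y)
  avoids {y} x≢y with f y in fy
  ... | nothing = nothing
  ... | just z′ = just λ { refl → x≢y (inj fx fy) }

Enumeration : ∀ {m} → List (Fin m) → Set
Enumeration B = Unique B × (∀ i → i ∈ B)

-- Two lists without repetitions and with the same members are permutations of each other; `B` is
-- compared with `allFin m`.
length-enumeration : ∀ {m} {B : List (Fin m)} → Enumeration B → length B ≡ m
length-enumeration {m} (B! , all∈B) = trans
  (↭-length (∼bag⇒↭ (unique∧set⇒bag B! (allFin⁺ m) (mk⇔ (λ _ → ∈-allFin _) (λ _ → all∈B _)))))
  (length-tabulate id)

-- Since `r` occurs only once in `P ∷ʳ r`, both splittings are made at the same place.
prefix-unique : ∀ {A : Set} {r : A} {S} P P′ → Unique (P ∷ʳ r) → P ∷ʳ r ≡ P′ ++ r ∷ S → P ≡ P′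
prefix-unique []      []           _         _  = refl
prefix-unique []      (_ ∷ [])     _         ()
prefix-unique []      (_ ∷ _ ∷ _)  _         ()
prefix-unique (x ∷ P) []           (x∉ ∷ _)  refl = contradiction refl (All.lookup x∉ (∈-++⁺ʳ P (here refl)))
prefix-unique (x ∷ P) (y ∷ P′)     (_ ∷ P!)  eq with refl , eq′ ← ∷-injective eq =
  cong (x ∷_) (prefix-unique P P′ P! eq′)

snoc-prefix : ∀ {A : Set} {r i : A} {S} Q P → Q ∷ʳ r ≡ P ++ i ∷ S → length P ≡ length Q → i ≡ r
snoc-prefix []      []      e _ = sym (proj₁ (∷-injective e))
snoc-prefix (_ ∷ Q) (_ ∷ P) e l = snoc-prefix Q P (proj₂ (∷-injective e)) (ℕ.suc-injective l)

-- Strings are functions in the game and vectors in the code. Passing through `Vec.tabulate` lets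
-- pointwise agreement suffice, without function extensionality.
tabulate-≗ : ∀ {A : Set} {n} {f : Fin n → A} {v : Vec A n} → (∀ i → f i ≡ lookup v i) → Vec.tabulate f ≡ v
tabulate-≗ {v = v} f≗v = trans (tabulate-cong f≗v) (tabulate∘lookup v)

-- Combining block strategies

-- The splitting is unique when `B` has no repetitions; then `P` is what Alice has received in this
-- block before `i`.
Follows : ∀ {m} → (List (Fin m) → Fin m → Bool) → List (Fin m) → (Fin m → Bool) → Fin m → Set
Follows write B w i = ∃₂ λ P S → B ≡ P ++ i ∷ S × w i ≡ write P i

-- The word w is read as inj₁ ℓ if ℓ is known to be the last position should the
-- block be the last one, and as inj₂ S if w shows that Merlin has completed the
-- block, with his position among the first k elements of S.
record BlockStrategy (k m : ℕ) : Set where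
  field
    write     : List (Fin m) → Fin m → Bool
    read      : (Fin m → Bool) → Fin m ⊎ List (Fin m)
    completed : ∀ {B w} → Enumeration B → (∀ i → Follows write B w i) →
                ∃ λ ℓ → read w ≡ inj₁ ℓ
    withheld  : ∀ {P r w} → Enumeration (P ∷ʳ r) → (∀ i → i ≢ r → Follows write (P ∷ʳ r) w i) →
                read w ≡ inj₁ r ⊎ (∃ λ S → read w ≡ inj₂ S × r ∈ take k S)

isInj₂? : ∀ {A B : Set} (s : A ⊎ B) → Dec (∃ λ b → s ≡ inj₂ b)
isInj₂? (inj₁ _) = no λ ()
isInj₂? (inj₂ b) = yes (b , refl)

module Combined {k m′ n : ℕ} (bs : BlockStrategy k (suc m′))
                (blocks : Fin (suc n) ↔ (Fin k × Fin (suc m′))) (k≤n : k ≤ suc n) where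
  open BlockStrategy bs
  open Inverse blocks using () renaming
    ( to to address; from to position
    ; strictlyInverseˡ to address-position; strictlyInverseʳ to position-address )

  m = suc m′

  Position = Fin (suc n)

  select : Fin k → Fin k × Fin m → Maybe (Fin m)
  select q (q′ , r) = if does (q′ ≟ q) then just r else nothing

  select-≡ : ∀ q r → select q (q , r) ≡ just r
  select-≡ q r rewrite dec-true (q ≟ q) refl = refl

  select⁻ : ∀ q {qr r} → select q qr ≡ just r → qr ≡ (q , r)
  select⁻ q {q′ , _} eq with q′ ≟ q
  select⁻ q refl | yes refl = refl

  inBlock : Fin k → Position → Maybe (Fin m)
  inBlock q i = select q (address i)

  inBlock-position : ∀ q r → inBlock q (position (q , r)) ≡ just r
  inBlock-position q r = trans (cong (select q) (address-position (q , r))) (select-≡ q r)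

  inBlock⁻ : ∀ q {i r} → inBlock q i ≡ just r → i ≡ position (q , r)
  inBlock⁻ q {i} eq = trans (sym (position-address i)) (cong position (select⁻ q eq))

  history : Fin k → List Position → List (Fin m)
  history q = mapMaybe (inBlock q)

  history-split : ∀ q r X Y → history q (X ++ position (q , r) ∷ Y) ≡ history q X ++ r ∷ history q Y
  history-split q r X Y = trans (mapMaybe-++ (inBlock q) X (position (q , r) ∷ Y))
    (cong (λ s → history q X ++ maybe′ _∷_ id s (history q Y)) (inBlock-position q r))

  block : (Position → Bool) → Fin k → Fin m → Bool
  block x q r = x (position (q , r))

  located : (Position → Bool) → Fin k → Position
  -- `zero` is the default for `inj₂`; `guess` consults `located` only after ruling that reading out
  -- for every block.
  located x q = position (q , fromInj₁ (const zero) (read (block x q)))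

  -- The decision is an argument so that `guessed` can split on it directly.
  guess : ∀ x → Dec (∃₂ λ q S → read (block x q) ≡ inj₂ S) → List Position
  guess x (yes (q , S , _)) = map (λ r → position (q , r)) (take k S)
  guess x (no _)            = tabulate (located x)

  length-guess : ∀ x d → length (guess x d) ≤ k
  length-guess x (yes (q , S , _)) = ℕ.≤-trans
    (ℕ.≤-reflexive (trans (length-map _ (take k S)) (length-take k S))) (ℕ.m⊓n≤m k (length S))
  length-guess x (no _)            = ℕ.≤-reflexive (length-tabulate (located x))

  centre? : ∀ x → Dec (∃₂ λ q S → read (block x q) ≡ inj₂ S)
  centre? x = any? λ q → isInj₂? (read (block x q))

  answer : ∀ x → ∃ λ S′ → fromList (guess x (centre? x)) ⊆ S′ × ∣ S′ ∣ ≡ k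
  answer x = enlarge k (fromList (guess x (centre? x)))
    (ℕ.≤-trans (∣fromList∣≤ (guess x (centre? x))) (length-guess x (centre? x))) k≤n

  respond : List Position → Fin k × Fin m → Bool
  respond L (q , r) = write (history q L) r

  strategy : Strategy k (suc n)
  strategy .alice L i  = respond L (address i)
  strategy .bob x      = proj₁ (answer x)
  strategy .bob-card x = proj₂ (proj₂ (answer x))

  -- A single play, seen block by block

  module Play (π : Permutation′ (suc n)) (b : Bool) where

    p : Position
    p = π ⟨$⟩ʳ fromℕ n

    x : Position → Bool
    x = play strategy π b

    time : Position → Position
    time i = π ⟨$⟩ˡ i

    order : List Position
    order = map (π ⟨$⟩ʳ_) (allFin (suc n))

    received-after : Position → List Position
    received-after j = map (π ⟨$⟩ʳ_) (filter (j <?_) (allFin (suc n)))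

    order-split : ∀ j → order ≡ received-before π j ++ (π ⟨$⟩ʳ j) ∷ received-after j
    order-split j = trans (cong (map (π ⟨$⟩ʳ_)) (allFin-split j))
                          (map-++ (π ⟨$⟩ʳ_) (filter (_<? j) (allFin (suc n))) _)

    played : ∀ i → i ≢ p → x i ≡ respond (received-before π (time i)) (address i)
    played i i≢p rewrite dec-false (time i ≟ fromℕ n)
      (λ eq → i≢p (trans (sym (inverseʳ π)) (cong (π ⟨$⟩ʳ_) eq))) = refl

    block-split : ∀ q r → let j = time (position (q , r)) in
                  history q order ≡ history q (received-before π j) ++ r ∷ history q (received-after j)
    block-split q r = trans
      (cong (history q) (trans (order-split j) (cong (λ i → received-before π j ++ i ∷ received-after j) (inverseʳ π))))
      (history-split q r (received-before π j) (received-after j))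
      where j = time (position (q , r))

    order-unique : Unique order
    order-unique = Unique.map⁺ (λ eq → trans (sym (inverseˡ π)) (trans (cong time eq) (inverseˡ π))) (allFin⁺ (suc n))

    enumerates : ∀ q → Enumeration (history q order)
    enumerates q =
      mapMaybe-unique (λ x≡ y≡ → trans (inBlock⁻ q x≡) (sym (inBlock⁻ q y≡))) order-unique ,
      λ r → subst (r ∈_) (sym (block-split q r)) (∈-insert (history q (received-before π (time (position (q , r))))))

    -- Alice's bit depends only on the history of the block concerned, so each block sees a play of
    -- its own, in the order induced by `π`.
    follows : ∀ q r → position (q , r) ≢ p → Follows write (history q order) (block x q) r
    follows q r ≢p = _ , _ , block-split q r ,
      trans (played i ≢p) (cong (respond (received-before π (time i))) (address-position (q , r)))
      where i = position (q , r)

    module _ {q : Fin k} {r : Fin m} (p≡ : position (q , r) ≡ p) where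

      same-address : ∀ {q′ r′} → position (q′ , r′) ≡ p → (q′ , r′) ≡ (q , r)
      same-address eq = trans (sym (address-position _)) (trans (cong address (trans eq (sym p≡))) (address-position _))

      others : ∀ q′ → q′ ≢ q → ∃ λ ℓ → read (block x q′) ≡ inj₁ ℓ
      others q′ q′≢q = completed (enumerates q′) λ i →
        follows q′ i λ eq → q′≢q (cong proj₁ (same-address eq))

      -- Merlin's position is last in the whole order, hence last in the induced order of its block.
      last-block : history q order ≡ history q (received-before π (fromℕ n)) ∷ʳ r
      last-block = begin
        history q order
          ≡⟨ cong (history q) (order-split (fromℕ n)) ⟩
        history q (received-before π (fromℕ n) ++ p ∷ received-after (fromℕ n))
          ≡⟨ cong₂ (λ i Y → history q (received-before π (fromℕ n) ++ i ∷ map (π ⟨$⟩ʳ_) Y)) (sym p≡)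
               (filter-none (fromℕ n <?_) (All.universal (λ i → ℕ.≤⇒≯ (≤fromℕ i)) (allFin (suc n)))) ⟩
        history q (received-before π (fromℕ n) ++ position (q , r) ∷ [])
          ≡⟨ history-split q r (received-before π (fromℕ n)) [] ⟩
        history q (received-before π (fromℕ n)) ∷ʳ r ∎
        where open ≡-Reasoning

      own : read (block x q) ≡ inj₁ r ⊎ (∃ λ S → read (block x q) ≡ inj₂ S × r ∈ take k S)
      own = withheld (subst Enumeration last-block (enumerates q)) λ i i≢r →
        subst (λ B → Follows write B (block x q) i) last-block
          (follows q i λ eq → i≢r (cong proj₂ (same-address eq)))

      -- By `others`, only Merlin's block can read as `inj₂`. If it does, its list contains his
      -- position; if no block does, `own` shows that his block names it as the last one.
      guessed : ∀ d → position (q , r) ∈ guess x d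
      guessed (no ¬c) with own
      ... | inj₁ eq           = subst (_∈ tabulate (located x)) (cong (λ s → position (q , fromInj₁ (const zero) s)) eq)
                                      (∈-tabulate⁺ {f = located x} q)
      ... | inj₂ (S , eq , _) = contradiction (q , S , eq) ¬c
      guessed (yes (q′ , S , eq)) with q′ ≟ q
      ... | no q′≢q with () ← trans (sym eq) (proj₂ (others q′ q′≢q))
      guessed (yes (q′ , S , eq)) | yes refl with own
      ... | inj₁ eq′ with () ← trans (sym eq) eq′
      guessed (yes (q′ , S , eq)) | yes refl | inj₂ (_ , eq′ , r∈S) with refl ← trans (sym eq) eq′ =
        ∈-map⁺ (λ r → position (q , r)) r∈S

  winning : Winning strategy
  winning π b = proj₁ (proj₂ (answer x))
    (∈-fromList⁺ (subst (_∈ guess x (centre? x)) p≡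
      (guessed {proj₁ (address p)} {proj₂ (address p)} p≡ (centre? x))))
    where
    open Play π b
    p≡ : position (address p) ≡ p
    p≡ = position-address p

-- A block of length 12

infix 4 _≟ₛ_

_≟ₛ_ : ∀ {n} (S T : Subset n) → Dec (S ≡ T)
_≟ₛ_ = Vec.≡-dec Bool._≟_

subsets : ∀ n → List (Subset n)
subsets zero    = [ [] ]
subsets (suc n) = map (inside ∷_) (subsets n) ++ map (outside ∷_) (subsets n)

kSubsets : ∀ n → ℕ → List (Subset n)
kSubsets n       zero    = [ ⊥ ]
kSubsets zero    (suc k) = []
kSubsets (suc n) (suc k) = map (outside ∷_) (kSubsets n (suc k)) ++ map (inside ∷_) (kSubsets n k)

∈-kSubsets : ∀ {n} (S : Subset n) → S ∈ kSubsets n ∣ S ∣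
∈-kSubsets []            = here refl
∈-kSubsets (inside  ∷ S) = ∈-++⁺ʳ (map (outside ∷_) (kSubsets _ (suc ∣ S ∣))) (∈-map⁺ (inside ∷_) (∈-kSubsets S))
-- `kSubsets` branches on the size, so the size is abstracted. For size 0 the only candidate is `⊥`,
-- and membership identifies `S` with it.
∈-kSubsets (outside ∷ S) with ∣ S ∣ | ∈-kSubsets S
... | zero  | here refl = here refl
... | suc _ | S∈        = ∈-++⁺ˡ (∈-map⁺ (outside ∷_) S∈)

Word : Set
Word = Subset 12

-- Distinct and nonzero, so they are the parity checks of a shortened Hamming code.
columns : Vec (Subset 4) 12
columns = Vec.fromList (take 12 (subsets 4))

syndrome : ∀ {m n} → Vec (Subset m) n → Subset n → Subset m
syndrome []      []      = ⊥
syndrome (h ∷ H) (b ∷ w) = if b then zipWith _xor_ h (syndrome H w) else syndrome H w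

columnIndex : Subset 4 → Maybe (Fin 12)
columnIndex s = find (λ ℓ → lookup columns ℓ ≟ₛ s) (allFin 12)

opaque
  -- Hamming decoding: flipping bit `ℓ` of a codeword turns its zero syndrome into column `ℓ`. A
  -- codeword yields `nothing`, as no column is zero.
  locate : Word → Maybe (Fin 12)
  locate w = columnIndex (syndrome columns w)

-- Gives each T the first remaining codeword that vanishes on T.  The enumeration
-- orders of subsets and kSubsets are chosen so that this never gets stuck; with
-- some other orders it does.
greedy : List Word → List Word → List (Word × Word)
greedy []       cs = []
greedy (T ∷ Ts) cs =
  maybe′ (λ c → (T , c) ∷ greedy Ts (filter (λ d → ¬? (d ≟ₛ c)) cs)) []
         (find (λ c → T ∩ c ≟ₛ ⊥) cs)

table : List (Word × Word)
table = greedy (kSubsets 12 3) (filter (λ w → syndrome columns w ≟ₛ ⊥) (subsets 12))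

encode decode : List (Word × Word) → Word → Word
encode t T = maybe′ proj₂ ⊥ (find (λ r → proj₁ r ≟ₛ T) t)
decode t c = maybe′ proj₁ ⊥ (find (λ r → proj₂ r ≟ₛ c) t)

-- With `T′` decoded from `c`, the field `decoded` makes the assignment of codewords to triples
-- injective. It would also fail for a triple missing from the table, as no lookup could return it.
record Good (T c T′ : Word) : Set where
  constructor good
  field
    disjoint : T ∩ c ≡ ⊥
    decoded  : T′ ≡ T
    small    : length (elements (∁ T)) ≤ 9
    centre   : locate c ≡ nothing
    leaves   : ∀ ℓ → locate (c [ ℓ ]%= not) ≡ just ℓ

good? : ∀ T c T′ → Dec (Good T c T′)
good? T c T′ = map′ (λ (d , e , s , z , l) → good d e s z l)
                    (λ (good d e s z l) → d , e , s , z , l)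
  (T ∩ c ≟ₛ ⊥ ×-dec T′ ≟ₛ T ×-dec length (elements (∁ T)) ≤? 9 ×-dec
   Maybe.≡-dec _≟_ (locate c) nothing ×-dec
   all? (λ ℓ → Maybe.≡-dec _≟_ (locate (c [ ℓ ]%= not)) (just ℓ)))

-- Abstracting over the table lets the evaluator compute it only once.
sound? : ∀ t → Dec (All (λ T → Good T (encode t T) (decode t (encode t T))) (kSubsets 12 3))
sound? t = All.all? (λ T → checkWord T (encode t T)) (kSubsets 12 3)
  where
  checkWord : ∀ T c → Dec (Good T c (decode t c))
  checkWord T c = good? T c (decode t c)

opaque
  unfolding locate

  -- Proved by evaluating the decision procedure on all 220 triples.
  table-sound : All (λ T → Good T (encode table T) (decode table (encode table T))) (kSubsets 12 3)
  table-sound = toWitness {a? = sound? table} _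

-- The block strategy, for any assignment of codewords satisfying `Good`

module Block (enc dec : Word → Word)
             (ok : ∀ T → ∣ T ∣ ≡ 3 → Good T (enc T) (dec (enc T))) where

  write : List (Fin 12) → Fin 12 → Bool
  -- Eight indices after the first three make eleven, so the negation hits exactly the twelfth and
  -- last one.
  write (a ∷ b ∷ c ∷ P) i = lookup (enc (fromList (a ∷ b ∷ c ∷ []))) i xor does (length P ℕ.≟ 8)
  write _               i = false

  interpret : Word → Fin 12 ⊎ List (Fin 12)
  interpret c = maybe′ inj₁ (inj₂ (elements (∁ (dec c)))) (locate c)

  ∉-disjoint : ∀ {T c : Word} {i} → T ∩ c ≡ ⊥ → i ∈ₛ T → lookup c i ≡ false
  ∉-disjoint {T} {c} {i} T∩c≡⊥ i∈T with lookup c i in eq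
  ... | false = refl
  ... | true  = contradiction (subst (i ∈ₛ_) T∩c≡⊥ (x∈p∩q⁺ (i∈T , lookup⇒[]= i c eq))) ∉⊥

  module _ {a b c r : Fin 12} {Q : List (Fin 12)} (E : Enumeration ((a ∷ b ∷ c ∷ Q) ∷ʳ r)) where

    T : Word
    T = fromList (a ∷ b ∷ c ∷ [])

    T-size : ∣ T ∣ ≡ 3
    T-size = ∣fromList∣ (Unique.take⁺ 3 (proj₁ E))

    open Good (ok T T-size)

    length-Q : length Q ≡ 8
    length-Q = ℕ.+-cancelʳ-≡ 1 (length Q) 8
      (trans (sym (length-++ Q)) (ℕ.+-cancelˡ-≡ 3 _ 9 (length-enumeration E)))

    -- The last index differs from the first three. This leaves nine candidates once `T` is known.
    r∉T : r ∉ₛ T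
    r∉T r∈T with a∉ ∷ b∉ ∷ c∉ ∷ _ ← proj₁ E =
      contradiction (trans (sym ([]=⇒lookup r∈T)) (∉-fromList⁺
        ((All.lookup a∉ (there (there r∈)) ∘ sym) ∷ (All.lookup b∉ (there r∈) ∘ sym) ∷ (All.lookup c∉ r∈ ∘ sym) ∷ []))) λ ()
      where
      r∈ : r ∈ Q ∷ʳ r
      r∈ = ∈-++⁺ʳ Q (here refl)

    zero-on-T : ∀ {v i} → v ≡ false → i ∈ a ∷ b ∷ c ∷ [] → v ≡ lookup (enc T) i
    zero-on-T eq i∈ = trans eq (sym (∉-disjoint disjoint (∈-fromList⁺ i∈)))

    -- On the first three positions both sides are 0, as the codeword vanishes on `T`. Later on, a
    -- negation would need eight predecessors after `T`, which would make `i` the last index.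
    early : ∀ w {i} → i ≢ r → Follows write ((a ∷ b ∷ c ∷ Q) ∷ʳ r) w i → w i ≡ lookup (enc T) i
    early w i≢r ([] , S , refl , eq)         = zero-on-T eq (here refl)
    early w i≢r (_ ∷ [] , S , refl , eq)     = zero-on-T eq (there (here refl))
    early w i≢r (_ ∷ _ ∷ [] , S , refl , eq) = zero-on-T eq (there (there (here refl)))
    early w {i} i≢r (_ ∷ _ ∷ _ ∷ P , S , e , eq)
      with refl , e₁ ← ∷-injective e
      with refl , e₂ ← ∷-injective e₁
      with refl , e₃ ← ∷-injective e₂ = begin
        w i                                         ≡⟨ eq ⟩
        lookup (enc T) i xor does (length P ℕ.≟ 8)  ≡⟨ cong (lookup (enc T) i xor_) (dec-false (length P ℕ.≟ 8)
                                                         λ l → i≢r (snoc-prefix Q P e₃ (trans l (sym length-Q)))) ⟩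
        lookup (enc T) i xor false                  ≡⟨ xor-comm (lookup (enc T) i) false ⟩
        lookup (enc T) i                            ∎
      where open ≡-Reasoning

    -- The history before `r` is forced to be `a ∷ b ∷ c ∷ Q`, whose length triggers the negation.
    late : ∀ w → Follows write ((a ∷ b ∷ c ∷ Q) ∷ʳ r) w r → w r ≡ not (lookup (enc T) r)
    late w (P , S , e , eq) with refl ← prefix-unique (a ∷ b ∷ c ∷ Q) P (proj₁ E) e = begin
      w r                                         ≡⟨ eq ⟩
      lookup (enc T) r xor does (length Q ℕ.≟ 8)  ≡⟨ cong (lookup (enc T) r xor_) (dec-true (length Q ℕ.≟ 8) length-Q) ⟩
      lookup (enc T) r xor true                   ≡⟨ xor-comm (lookup (enc T) r) true ⟩
      not (lookup (enc T) r)                      ∎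
      where open ≡-Reasoning

    -- This covers both Alice's ending of a block and a bit of Merlin's that agrees with what she
    -- would have written.
    leaf-read : ∀ w → (∀ i → i ≢ r → w i ≡ lookup (enc T) i) → w r ≡ not (lookup (enc T) r) →
                interpret (Vec.tabulate w) ≡ inj₁ r
    leaf-read w agree differ = begin
      interpret (Vec.tabulate w)       ≡⟨ cong interpret (tabulate-≗ pointwise) ⟩
      interpret (enc T [ r ]%= not)    ≡⟨ cong (maybe′ inj₁ _) (leaves r) ⟩
      inj₁ r                           ∎
      where
      open ≡-Reasoning
      pointwise : ∀ i → w i ≡ lookup (enc T [ r ]%= not) i
      pointwise i with i ≟ r
      ... | yes refl = trans differ (sym (lookup∘updateAt i (enc T)))
      ... | no i≢r   = trans (agree i i≢r) (sym (lookup∘updateAt′ i r i≢r (enc T)))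

    centre-read : ∀ w → (∀ i → i ≢ r → w i ≡ lookup (enc T) i) → w r ≡ lookup (enc T) r →
                  interpret (Vec.tabulate w) ≡ inj₂ (elements (∁ T))
    centre-read w agree same = begin
      interpret (Vec.tabulate w)                ≡⟨ cong interpret (tabulate-≗ pointwise) ⟩
      interpret (enc T)                         ≡⟨ cong (maybe′ inj₁ _) centre ⟩
      inj₂ (elements (∁ (dec (enc T))))         ≡⟨ cong (λ S → inj₂ (elements (∁ S))) decoded ⟩
      inj₂ (elements (∁ T))                     ∎
      where
      open ≡-Reasoning
      pointwise : ∀ i → w i ≡ lookup (enc T) i
      pointwise i with i ≟ r
      ... | yes refl = same
      ... | no i≢r   = agree i i≢r

    r-guessed : r ∈ take 9 (elements (∁ T))
    r-guessed = subst (r ∈_) (sym (take-all 9 (elements (∁ T)) small))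
      (∈-filter⁺ (_∈? ∁ T) (∈-allFin r) (x∉p⇒x∈∁p r∉T))

  completed : ∀ {B w} → Enumeration B → (∀ i → Follows write B w i) →
              ∃ λ ℓ → interpret (Vec.tabulate w) ≡ inj₁ ℓ
  completed {B} {w} E f with initLast B
  ... | []                       with () ← length-enumeration E
  ... | [] ∷ʳ′ _                 with () ← length-enumeration E
  ... | (_ ∷ []) ∷ʳ′ _           with () ← length-enumeration E
  ... | (_ ∷ _ ∷ []) ∷ʳ′ _       with () ← length-enumeration E
  ... | (_ ∷ _ ∷ _ ∷ _) ∷ʳ′ r = r , leaf-read E w (λ i i≢r → early E w i≢r (f i)) (late E w (f r))

  withheld : ∀ {P r w} → Enumeration (P ∷ʳ r) → (∀ i → i ≢ r → Follows write (P ∷ʳ r) w i) →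
             interpret (Vec.tabulate w) ≡ inj₁ r ⊎
             (∃ λ S → interpret (Vec.tabulate w) ≡ inj₂ S × r ∈ take 9 S)
  withheld {[]}         E f with () ← length-enumeration E
  withheld {_ ∷ []}     E f with () ← length-enumeration E
  withheld {_ ∷ _ ∷ []} E f with () ← length-enumeration E
  -- Merlin has two options: a bit unlike the codeword's leaves a word at distance 1, an equal bit
  -- completes the codeword itself.
  withheld {_ ∷ _ ∷ _ ∷ _} {r} {w} E f with w r Bool.≟ lookup (enc (T E)) r
  ... | no differ = inj₁ (leaf-read E w (λ i i≢r → early E w i≢r (f i i≢r)) (¬-not differ))
  ... | yes same  = inj₂ (_ , centre-read E w (λ i i≢r → early E w i≢r (f i i≢r)) same , r-guessed E)

  blockStrategy : BlockStrategy 9 12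
  blockStrategy = record
    { write = write ; read = interpret ∘ Vec.tabulate ; completed = completed ; withheld = withheld }

theorem2 : Σ (Strategy 9 108) Winning
theorem2 = strategy , winning
  where
  decodable : ∀ T → ∣ T ∣ ≡ 3 → Good T (encode table T) (decode table (encode table T))
  decodable T ∣T∣≡3 = All.lookup table-sound (subst (λ k → T ∈ kSubsets 12 k) ∣T∣≡3 (∈-kSubsets T))
  open Block (encode table) (decode table) decodable
  -- `*↔×` cuts the 108 = 9 · 12 positions into the blocks; the last argument is 9 ≤ 108, which
  -- leaves room to enlarge Bob's set.
  open Combined blockStrategy *↔× (ℕ.m≤m*n 9 12)
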